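{- The sequence $\left(|I_k(123,132,213,231)|\right)_{k\ge 0}$ is the Pascal triangle read row by row (starting with $\binom{0}{0}$ at $k=0$), except that all values greater than $1$ are replaced by $0$. Its generating function is \[\sum_{k\ge 0}|I_k(123,132,213,231)|\,x^k=\sum_{i\ge 0}\left(x^{i(i+1)/2}+x^{(i+1)(i+4)/2}\right).\]
   Context: A permutation of length $n$ is a word $\pi=\pi_1\cdots\pi_n$ containing each of $1,\dots,n$ exactly once. The sum of permutations $\rho=\rho_1\cdots\rho_n$ and $\tau=\tau_1\cdots\tau_m$ is the permutation $\rho\oplus\tau=\rho_1\cdots\rho_n(n+\tau_1)\cdots(n+\tau_m)$ of length $n+m$. A permutation is decomposable if it equals $\rho\oplus\tau$ for some non-empty permutations $\rho,\tau$; a non-empty permutation that is not decomposable is indecomposable. An inversion of $\pi$ is a pair $(i,j)$ with $i<j$ and $\pi_i>\pi_j$. A permutation $\pi$ contains a permutation (pattern) $\tau=\tau_1\cdots\tau_m$ if there are indices $i_1<\dots<i_m$ such that $\pi_{i_1},\dots,\pi_{i_m}$ is order-isomorphic to $\tau_1,\dots,\tau_m$; otherwise $\pi$ avoids $\tau$. $I_k(\tau_1,\dots,\tau_r)$ denotes the (finite) set of all indecomposable permutations, of any length, with exactly $k$ inversions that avoid all of $\tau_1,\dots,\tau_r$. Reading the Pascal triangle row by row means listing $\binom{0}{0},\binom{1}{0},\binom{1}{1},\binom{2}{0},\binom{2}{1},\binom{2}{2},\dots$ -}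

module Defs where

open import Data.Bool.Base using (if_then_else_)
open import Data.Fin.Base as Fin using (Fin)
import Data.Fin.Properties as Fin
open import Data.List.Base
  using (List; []; _++_; length; map; upTo; allFin; lookup; filter; cartesianProduct)
open import Data.List.Membership.Propositional using (_∈_)
open import Data.List.Relation.Binary.Permutation.Propositional using (_↭_)
open import Data.List.Relation.Unary.All using (All)
open import Data.List.Relation.Unary.Unique.Propositional using (Unique)
open import Data.Nat.Base using (ℕ; zero; suc; _+_; _<_; _>_; _≤_)
open import Data.Nat.Combinatorics using (_C_)
open import Data.Nat.GeneralisedArithmetic using (fold)
open import Data.Nat.Properties using (_≟_; _<?_; _>?_)
open import Data.Product.Base using (_×_; _,_; ∃₂; ∃-syntax; Σ-syntax)
open import Function.Bundles using (_⇔_)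
open import Level using (Level; 0ℓ; _⊔_)
open import Relation.Binary.PropositionalEquality.Core using (_≡_; _≢_)
open import Relation.Nullary.Decidable.Core using (Dec; does; _×-dec_)
open import Relation.Nullary.Negation.Core using (¬_)
open import Relation.Unary using (Pred)

Word : Set
Word = List ℕ

IsPermutation : Pred Word 0ℓ
IsPermutation π = π ↭ map suc (upTo (length π))

infixr 5 _⊕_

_⊕_ : Word → Word → Word
ρ ⊕ τ = ρ ++ map (length ρ +_) τ

Decomposable : Pred Word 0ℓ
Decomposable π = ∃₂ λ ρ τ →
  (IsPermutation ρ × ρ ≢ []) × (IsPermutation τ × τ ≢ []) × π ≡ ρ ⊕ τ

Indecomposable : Pred Word 0ℓ
Indecomposable π = π ≢ [] × ¬ Decomposable π

Position : Word → Set
Position π = Fin (length π)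

IsInversion : (π : Word) → Pred (Position π × Position π) 0ℓ
IsInversion π (i , j) = i Fin.< j × lookup π i > lookup π j

isInversion? : (π : Word) (p : Position π × Position π) → Dec (IsInversion π p)
isInversion? π (i , j) = (i Fin.<? j) ×-dec (lookup π i >? lookup π j)

inversions : Word → ℕ
inversions π = length (filter (isInversion? π) (cartesianProduct positions positions))
  where
  positions : List (Position π)
  positions = allFin (length π)

_Contains_ : Word → Word → Set
π Contains τ = Σ[ ι ∈ (Position τ → Position π) ]
    (∀ {a b : Position τ} → a Fin.< b → ι a Fin.< ι b)
  × (∀ (a b : Position τ) → lookup π (ι a) < lookup π (ι b) ⇔ lookup τ a < lookup τ b)

_Avoids_ : Word → Word → Set
π Avoids τ = ¬ (π Contains τ)

I : ℕ → List Word → Pred Word 0ℓ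
I k τs π =
  IsPermutation π × Indecomposable π × inversions π ≡ k × All (π Avoids_) τs

HasCardinality : ∀ {a ℓ : Level} {A : Set a} → Pred A ℓ → ℕ → Set (a ⊔ ℓ)
HasCardinality P n =
  ∃[ xs ] Unique xs × (∀ x → x ∈ xs ⇔ P x) × length xs ≡ n

-- (n , m) stands for entry m of row n, 0 ≤ m ≤ n.
nextEntry : ℕ × ℕ → ℕ × ℕ
nextEntry (n , m) = if does (m <? n) then (n , suc m) else (suc n , 0)

pascal : ℕ → ℕ
pascal k = let (n , m) = fold (0 , 0) nextEntry k in n C m

zeroAboveOne : ℕ → ℕ
zeroAboveOne v = if does (v >? 1) then 0 else v

-- Formal power series over ℕ, identified with their coefficient sequences.
Series : Set
Series = ℕ → ℕ

x^_ : ℕ → Series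
(x^ a) k = if does (k ≟ a) then 1 else 0

infix  8 x^_
infixl 6 _⊞_

_⊞_ : Series → Series → Series
(f ⊞ g) k = f k + g k

partialSum : (ℕ → Series) → ℕ → Series
partialSum f zero    = λ _ → 0
partialSum f (suc n) = partialSum f n ⊞ f n

-- f = Σ_{i ≥ 0} g i as formal power series: each coefficient
-- of the partial sums is eventually constant, equal to that of f.
_IsSumOf_ : Series → (ℕ → Series) → Set
f IsSumOf g = ∀ k → ∃[ N ] ∀ n → N ≤ n → partialSum g n k ≡ f k

{-# OPTIONS --safe #-}
module Submission where

-- A word with distinct entries avoids 123, 132, 213 and 231 exactly when the first entry of
-- every subsequence of length three is the largest of the three (avoids⇒dominant,
-- dominant⇒avoids): of the six patterns of length three only 312 and 321 survive. In such a
-- permutation of length at least three the first entry therefore exceeds all later ones, and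
-- after its removal the same holds for the rest. Hence the permutation is decreasing, except
-- that its last two entries may be 1 2 instead of 2 1 (shape). Every permutation that begins
-- with its maximum is indecomposable, so among these words only 12 itself and the empty word
-- are excluded.
--
-- A maximum placed in front of w adds length w inversions (inversions-∷). With T n the n-th
-- triangular number, the decreasing permutation of length n + 1 has T n inversions, and the
-- permutation of length n + 3 that ends in 1 2 has T (n + 1) + (n + 1) inversions. Entry m of
-- row n of the Pascal triangle is read at index T n + m (coordinates-triangle), so these
-- numbers are exactly the indices of the first entries of the rows, and of the last entries of
-- the rows after row 0, without repetition. These entries are the ones equal to 1; all others
-- exceed 1.
--
-- The generating function sums one monomial over the row starts T i and one over the row ends
-- T (i + 1) + (i + 1), and these are the exponents i(i+1)/2 and (i+1)(i+4)/2.

open import Defs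
open import Data.List.Base using (List; []; _∷_)
open import Data.Nat.Base using (ℕ; _+_; _*_; _/_)
open import Data.Product.Base using (_×_; Σ-syntax)
open import Relation.Binary.PropositionalEquality.Core using (_≡_)

open import Data.Bool.Base using (if_then_else_)
open import Data.Empty using (⊥-elim)
open import Data.Fin.Base as Fin using (Fin)
open import Data.Fin.Patterns using (0F; 1F; 2F)
open import Data.List.Base
  using (_++_; [_]; _∷ʳ_; length; map; upTo; allFin; lookup; filter; cartesianProduct)
open import Data.List.Membership.Propositional using (_∈_)
open import Data.List.Membership.Propositional.Properties
  using (∈-map⁻; ∈-upTo⁻; ∈-++⁺ʳ; ∈-lookup)
open import Data.List.Properties
  using (length-map; length-++; length-tabulate; map-++; map-tabulate; upTo-∷ʳ;
         filter-++; filter-all; filter-reject; filter-≐)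
open import Data.List.Relation.Binary.Permutation.Propositional
  using (_↭_; ↭-refl; ↭-sym; ↭-trans; ↭-prep; ↭-swap; ↭-reflexive; ↭⇒↭ₛ)
open import Data.List.Relation.Binary.Permutation.Propositional.Properties
  using (∈-resp-↭; ∷↭∷ʳ; drop-∷; ↭-singleton-inv)
open import Data.List.Relation.Binary.Permutation.Setoid.Properties using (Unique-resp-↭)
open import Data.List.Relation.Unary.All as All using (All; []; _∷_)
import Data.List.Relation.Unary.All.Properties as All
open import Data.List.Relation.Unary.AllPairs using ([]; _∷_)
open import Data.List.Relation.Unary.Any using (here; there; index)
open import Data.List.Relation.Unary.Any.Properties using (lookup-index)
open import Data.List.Relation.Unary.Unique.Propositional using (Unique)
import Data.List.Relation.Unary.Unique.Propositional.Properties as Unique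
open import Data.Nat.Base
  using (zero; suc; _<_; _≤_; z≤n; s≤s; z<s; s<s; s<s⁻¹; s≤s⁻¹)
open import Data.Nat.Combinatorics using (_C_; nCn≡1; nCk+nC[k+1]≡[n+1]C[k+1])
open import Data.Nat.DivMod using (m*n/n≡m)
open import Data.Nat.GeneralisedArithmetic using (fold)
open import Data.Nat.Properties
open import Data.Nat.Solver using (module +-*-Solver)
open import Data.Product.Base using (_,_; proj₁; proj₂; ∃-syntax)
open import Data.Product.Properties using (,-injective)
open import Data.Sum.Base using (_⊎_; inj₁; inj₂)
open import Function.Base using (_∘_; id)
open import Function.Bundles using (_⇔_; mk⇔; module Equivalence)
open import Level using (Level)
open import Relation.Binary.Definitions using (tri<; tri≈; tri>)
open import Relation.Binary.PropositionalEquality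
  using (_≢_; refl; sym; trans; cong; cong₂; subst; setoid; module ≡-Reasoning)
open import Relation.Nullary.Decidable using (dec-true; dec-false; yes; no)
open import Relation.Nullary.Negation using (¬_; contradiction)
open import Relation.Unary using (Pred; Decidable)

private
  variable
    a b ℓ : Level
    A : Set a
    B : Set b

-- The four patterns 123, 132, 213, 231.
patterns₄ : List Word
patterns₄ = (1 ∷ 2 ∷ 3 ∷ []) ∷ (1 ∷ 3 ∷ 2 ∷ []) ∷ (2 ∷ 1 ∷ 3 ∷ []) ∷ (2 ∷ 3 ∷ 1 ∷ []) ∷ []

-- Permutations that begin with their maximum

range-suc : ∀ n → map suc (upTo (suc n)) ≡ map suc (upTo n) ∷ʳ suc n
range-suc n = trans (cong (map suc) (sym (upTo-∷ʳ n))) (map-++ suc (upTo n) [ n ])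

perm-bounded : ∀ {π x} → IsPermutation π → x ∈ π → x ≤ length π
perm-bounded perm x∈π with ∈-map⁻ suc (∈-resp-↭ perm x∈π)
... | _ , y∈ , refl = ∈-upTo⁻ y∈

prependMax-perm : ∀ {w} → IsPermutation w → IsPermutation (suc (length w) ∷ w)
prependMax-perm {w} perm =
  ↭-trans (↭-prep _ perm)
    (↭-trans (∷↭∷ʳ _ _) (↭-reflexive (sym (range-suc (length w)))))

-- A first entry that exceeds all others can only be the length, and the rest is a permutation.
peelMax : ∀ {x w} → IsPermutation (x ∷ w) → All (_< x) w →
          x ≡ suc (length w) × IsPermutation w
peelMax {x} {w} perm w<x = x≡max , drop-∷ x∷w↭x∷range
  where
  max∈ : suc (length w) ∈ x ∷ w
  max∈ = ∈-resp-↭ (↭-sym perm)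
    (subst (suc (length w) ∈_) (sym (range-suc (length w)))
      (∈-++⁺ʳ (map suc (upTo (length w))) (here refl)))

  x≡max : x ≡ suc (length w)
  x≡max with max∈
  ... | here eq   = sym eq
  ... | there m∈w =
    contradiction (perm-bounded perm (here refl)) (<⇒≱ (All.lookup w<x m∈w))

  x∷w↭x∷range : x ∷ w ↭ x ∷ map suc (upTo (length w))
  x∷w↭x∷range = ↭-trans perm
    (↭-trans (↭-reflexive (trans (range-suc (length w))
                                 (cong (map suc (upTo (length w)) ∷ʳ_) (sym x≡max))))
      (↭-sym (∷↭∷ʳ x _)))

-- In a sum of two non-empty permutations the first entry is at most the length of the first
-- summand, hence smaller than the length of the sum.
startsWithMax⇒indecomposable : ∀ w → Indecomposable (suc (length w) ∷ w)
startsWithMax⇒indecomposable w = (λ ()) , indecomposable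
  where
  indecomposable : ¬ Decomposable (suc (length w) ∷ w)
  indecomposable ([] , _ , (_ , ρ≢[]) , _) = ρ≢[] refl
  indecomposable (_ ∷ _ , [] , _ , (_ , τ≢[]) , _) = τ≢[] refl
  indecomposable (_ ∷ ρ , t ∷ τ , (ρ-perm , _) , _ , refl) =
    contradiction (perm-bounded ρ-perm (here refl))
      (<⇒≱ (s<s (subst (length ρ <_) (sym (length-++ ρ)) (m<m+n (length ρ) z<s))))

perm-unique : ∀ {π} → IsPermutation π → Unique π
perm-unique {π} perm =
  Unique-resp-↭ (setoid ℕ) (↭⇒↭ₛ (↭-sym perm))
    (Unique.map⁺ suc-injective (Unique.upTo⁺ (length π)))

-- Avoidance of the four patterns

-- In every subsequence of length three the first entry is the largest.
Dominant : Word → Set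
Dominant π = ∀ {i j k : Position π} → i Fin.< j → j Fin.< k →
  lookup π j < lookup π i × lookup π k < lookup π i

dominant-tail : ∀ {x w} → Dominant (x ∷ w) → Dominant w
dominant-tail dom i<j j<k = dom (s<s i<j) (s<s j<k)

dominant-∷ : ∀ {x w} → All (_< x) w → Dominant w → Dominant (x ∷ w)
dominant-∷ w<x dom {0F}        {Fin.suc _} {Fin.suc _} _ _ =
  All.lookup w<x (∈-lookup _) , All.lookup w<x (∈-lookup _)
dominant-∷ w<x dom {Fin.suc _} {Fin.suc _} {Fin.suc _} i<j j<k =
  dom (s<s⁻¹ i<j) (s<s⁻¹ j<k)

-- Any later position belongs to a triple with the first position and one further position,
-- provided the word has at least three entries.
dominant-head : ∀ {x a b w} → Dominant (x ∷ a ∷ b ∷ w) → All (_< x) (a ∷ b ∷ w)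
dominant-head {x} {a} {b} {w} dom = All.tabulate λ y∈ →
  subst (_< x) (sym (lookup-index y∈)) (below (index y∈))
  where
  below : ∀ j → lookup (a ∷ b ∷ w) j < x
  below 0F          = proj₁ (dom {0F} {1F} {2F} z<s (s<s z<s))
  below (Fin.suc j) = proj₂ (dom {0F} {1F} {Fin.suc (Fin.suc j)} z<s (s<s z<s))

dominant-short : ∀ {x y} → Dominant (x ∷ y ∷ [])
dominant-short {i = 0F} {1F} {1F} _ (s≤s ())
dominant-short {i = 1F} {1F} (s≤s ()) _

dominant-contains : ∀ {π s t u} → Dominant π → π Contains (s ∷ t ∷ u ∷ []) → t < s × u < s
dominant-contains dom (ι , mono , iso) =
  let p , q = dom (mono {0F} {1F} z<s) (mono {1F} {2F} (s<s z<s))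
  in Equivalence.to (iso _ _) p , Equivalence.to (iso _ _) q

dominant⇒avoids : ∀ {π} → Dominant π → All (π Avoids_) patterns₄
dominant⇒avoids {π} dom =
  (λ c → <⇒≱ (proj₁ (first c)) (s≤s z≤n)) ∷
  (λ c → <⇒≱ (proj₁ (first c)) (s≤s z≤n)) ∷
  (λ c → <⇒≱ (proj₂ (first c)) (s≤s (s≤s z≤n))) ∷
  (λ c → <⇒≱ (proj₁ (first c)) (s≤s (s≤s z≤n))) ∷ []
  where
  first : ∀ {s t u} → π Contains (s ∷ t ∷ u ∷ []) → t < s × u < s
  first = dominant-contains {π} dom

-- x and y are distinct, s and t are distinct, and both pairs are ordered in the same way.
SameOrder : ℕ → ℕ → ℕ → ℕ → Set
SameOrder x y s t = (x < y × s < t) ⊎ (y < x × t < s)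

sameOrder⇒⇔ : ∀ {x y s t} → SameOrder x y s t → x < y ⇔ s < t
sameOrder⇒⇔ (inj₁ (x<y , s<t)) = mk⇔ (λ _ → s<t) (λ _ → x<y)
sameOrder⇒⇔ (inj₂ (y<x , t<s)) =
  mk⇔ (λ x<y → contradiction y<x (<-asym x<y)) (λ s<t → contradiction t<s (<-asym s<t))

sameOrder-swap : ∀ {x y s t} → SameOrder x y s t → SameOrder y x t s
sameOrder-swap (inj₁ p) = inj₂ p
sameOrder-swap (inj₂ p) = inj₁ p

<-refl⇔ : ∀ {x s} → x < x ⇔ s < s
<-refl⇔ = mk⇔ (λ p → contradiction refl (<⇒≢ p)) (λ p → contradiction refl (<⇒≢ p))

contains-triple : ∀ π {s t u} {i j k : Position π} → i Fin.< j → j Fin.< k →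
  SameOrder (lookup π i) (lookup π j) s t →
  SameOrder (lookup π i) (lookup π k) s u →
  SameOrder (lookup π j) (lookup π k) t u →
  π Contains (s ∷ t ∷ u ∷ [])
contains-triple π {s} {t} {u} {i} {j} {k} i<j j<k st su tu = ι , (λ {p} {q} → mono p q) , iso
  where
  τ : Word
  τ = s ∷ t ∷ u ∷ []

  ι : Position τ → Position π
  ι 0F = i
  ι 1F = j
  ι 2F = k

  mono : ∀ p q → p Fin.< q → ι p Fin.< ι q
  mono 0F 1F _ = i<j
  mono 0F 2F _ = <-trans i<j j<k
  mono 1F 1F (s≤s ())
  mono 1F 2F _ = j<k
  mono 2F 1F (s≤s ())
  mono 2F 2F (s≤s (s≤s ()))

  iso : ∀ p q → lookup π (ι p) < lookup π (ι q) ⇔ lookup τ p < lookup τ q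
  iso 0F 0F = <-refl⇔
  iso 0F 1F = sameOrder⇒⇔ st
  iso 0F 2F = sameOrder⇒⇔ su
  iso 1F 0F = sameOrder⇒⇔ (sameOrder-swap st)
  iso 1F 1F = <-refl⇔
  iso 1F 2F = sameOrder⇒⇔ tu
  iso 2F 0F = sameOrder⇒⇔ (sameOrder-swap su)
  iso 2F 1F = sameOrder⇒⇔ (sameOrder-swap tu)
  iso 2F 2F = <-refl⇔

unique-lookup : ∀ {π} → Unique π → {i j : Position π} → i Fin.< j → lookup π i ≢ lookup π j
unique-lookup (x∉w ∷ _) {0F}        {Fin.suc j} _   = All.lookup x∉w (∈-lookup j)
unique-lookup (_ ∷ uw)  {Fin.suc _} {Fin.suc _} i<j = unique-lookup uw (s<s⁻¹ i<j)

-- If the first entry of a triple is not the largest, then the order of the three entries is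
-- that of 123, 132, 213 or 231.
avoids⇒dominant : ∀ {π} → Unique π → All (π Avoids_) patterns₄ → Dominant π
avoids⇒dominant {π} uniq (¬123 ∷ ¬132 ∷ ¬213 ∷ ¬231 ∷ []) {i} {j} {k} i<j j<k
  with <-cmp (lookup π i) (lookup π j)
     | <-cmp (lookup π i) (lookup π k)
     | <-cmp (lookup π j) (lookup π k)
... | tri≈ _ x≡y _ | _ | _ = contradiction x≡y (unique-lookup uniq i<j)
... | _ | tri≈ _ x≡z _ | _ = contradiction x≡z (unique-lookup uniq (<-trans i<j j<k))
... | _ | _ | tri≈ _ y≡z _ = contradiction y≡z (unique-lookup uniq j<k)
... | tri> _ _ y<x | tri> _ _ z<x | _ = y<x , z<x
... | tri< x<y _ _ | tri< x<z _ _ | tri< y<z _ _ = ⊥-elim (¬123 (contains-triple π i<j j<k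
  (inj₁ (x<y , s<s z<s)) (inj₁ (x<z , s<s z<s)) (inj₁ (y<z , s<s (s<s z<s)))))
... | tri< x<y _ _ | tri< x<z _ _ | tri> _ _ z<y = ⊥-elim (¬132 (contains-triple π i<j j<k
  (inj₁ (x<y , s<s z<s)) (inj₁ (x<z , s<s z<s)) (inj₂ (z<y , s<s (s<s z<s)))))
... | tri> _ _ y<x | tri< x<z _ _ | _ = ⊥-elim (¬213 (contains-triple π i<j j<k
  (inj₂ (y<x , s<s z<s)) (inj₁ (x<z , s<s (s<s z<s))) (inj₁ (<-trans y<x x<z , s<s z<s))))
... | tri< x<y _ _ | tri> _ _ z<x | _ = ⊥-elim (¬231 (contains-triple π i<j j<k
  (inj₁ (x<y , s<s (s<s z<s))) (inj₂ (z<x , s<s z<s)) (inj₂ (<-trans z<x x<y , s<s z<s))))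

-- Inversions

length-filter-map : ∀ {P : Pred B ℓ} (P? : Decidable P) (f : A → B) xs →
  length (filter P? (map f xs)) ≡ length (filter (P? ∘ f) xs)
length-filter-map P? f []       = refl
length-filter-map P? f (x ∷ xs) with P? (f x)
... | yes _ = cong suc (length-filter-map P? f xs)
... | no  _ = length-filter-map P? f xs

-- The pairs of positions are split by whether their first component is the position of x.
-- Each pair of the position of x with a later one is an inversion; the other inversions are
-- those of w, shifted.
inversions-∷ : ∀ {x w} → All (_< x) w → inversions (x ∷ w) ≡ length w + inversions w
inversions-∷ {x} {w} w<x = begin
  inversions (x ∷ w)
    ≡⟨ cong (λ S → length (filter P? (cartesianProduct (0F ∷ S) (0F ∷ S))))
         (map-tabulate id Fin.suc) ⟨
  length (filter P? ((0F , 0F) ∷ pairs 0F ++ lower (allFin n)))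
    ≡⟨ cong length (filter-reject P? {0F , 0F} {pairs 0F ++ lower (allFin n)} (λ ())) ⟩
  length (filter P? (pairs 0F ++ lower (allFin n)))
    ≡⟨ cong length (filter-++ P? (pairs 0F) (lower (allFin n))) ⟩
  length (filter P? (pairs 0F) ++ filter P? (lower (allFin n)))
    ≡⟨ length-++ (filter P? (pairs 0F)) ⟩
  length (filter P? (pairs 0F)) + length (filter P? (lower (allFin n)))
    ≡⟨ cong₂ _+_ top (lower-rows (allFin n)) ⟩
  n + inversions w ∎
  where
  open ≡-Reasoning
  n = length w
  P? = isInversion? (x ∷ w)
  Q? = isInversion? w

  -- The positions of w, as positions of x ∷ w.
  shifted : List (Fin (suc n))
  shifted = map Fin.suc (allFin n)

  pairs : Fin (suc n) → List (Fin (suc n) × Fin (suc n))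
  pairs i = map (i ,_) shifted

  -- The pairs whose first component is the shift of an element of the given list.
  lower : List (Fin n) → List (Fin (suc n) × Fin (suc n))
  lower is = cartesianProduct (map Fin.suc is) (0F ∷ shifted)

  top-all : All (IsInversion (x ∷ w)) (pairs 0F)
  top-all = All.map⁺ {f = 0F ,_} (All.map⁺ {f = Fin.suc}
    (All.universal (λ j → z<s , All.lookup w<x (∈-lookup j)) (allFin n)))

  top : length (filter P? (pairs 0F)) ≡ n
  top = begin
    length (filter P? (pairs 0F)) ≡⟨ cong length (filter-all P? top-all) ⟩
    length (pairs 0F)             ≡⟨ length-map {B = Fin (suc n) × Fin (suc n)} (0F ,_) shifted ⟩
    length shifted                ≡⟨ length-map Fin.suc (allFin n) ⟩
    length (allFin n)             ≡⟨ length-tabulate id ⟩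
    n                             ∎

  row : ∀ i → length (filter P? ((Fin.suc i , 0F) ∷ pairs (Fin.suc i))) ≡
              length (filter Q? (map (i ,_) (allFin n)))
  row i = begin
    length (filter P? ((Fin.suc i , 0F) ∷ pairs (Fin.suc i)))
      ≡⟨ cong length (filter-reject P? {Fin.suc i , 0F} {pairs (Fin.suc i)} (λ ())) ⟩
    length (filter P? (pairs (Fin.suc i)))
      ≡⟨ length-filter-map P? _ shifted ⟩
    length (filter (P? ∘ (Fin.suc i ,_)) shifted)
      ≡⟨ length-filter-map (P? ∘ (Fin.suc i ,_)) Fin.suc (allFin n) ⟩
    length (filter (λ j → P? (Fin.suc i , Fin.suc j)) (allFin n))
      ≡⟨ cong length (filter-≐ (λ j → P? (Fin.suc i , Fin.suc j)) (λ j → Q? (i , j))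
           ((λ (i<j , p) → s<s⁻¹ i<j , p) , (λ (i<j , p) → s<s i<j , p)) (allFin n)) ⟩
    length (filter (λ j → Q? (i , j)) (allFin n))
      ≡⟨ length-filter-map Q? (i ,_) (allFin n) ⟨
    length (filter Q? (map (i ,_) (allFin n))) ∎

  lower-rows : ∀ is → length (filter P? (lower is)) ≡
                      length (filter Q? (cartesianProduct is (allFin n)))
  lower-rows []       = refl
  lower-rows (i ∷ is) = begin
    length (filter P? (pairs₀ ++ lower is))
      ≡⟨ cong length (filter-++ P? pairs₀ (lower is)) ⟩
    length (filter P? pairs₀ ++ filter P? (lower is))
      ≡⟨ length-++ (filter P? pairs₀) ⟩
    length (filter P? pairs₀) + length (filter P? (lower is))
      ≡⟨ cong₂ _+_ (row i) (lower-rows is) ⟩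
    length (filter Q? (map (i ,_) (allFin n))) + length (filter Q? (cartesianProduct is (allFin n)))
      ≡⟨ length-++ (filter Q? (map (i ,_) (allFin n))) ⟨
    length (filter Q? (map (i ,_) (allFin n)) ++ filter Q? (cartesianProduct is (allFin n)))
      ≡⟨ cong length (filter-++ Q? (map (i ,_) (allFin n)) (cartesianProduct is (allFin n))) ⟨
    length (filter Q? (cartesianProduct (i ∷ is) (allFin n))) ∎
    where
    pairs₀ : List (Fin (suc n) × Fin (suc n))
    pairs₀ = (Fin.suc i , 0F) ∷ pairs (Fin.suc i)

-- Classification of the permutations

-- w preceded by m successive new maxima: for a permutation w of length l, this is the word
-- (l + m) ... (l + 1) followed by w.
prependMaxima : ℕ → Word → Word
prependMaxima zero    w = w
prependMaxima (suc m) w = suc (length (prependMaxima m w)) ∷ prependMaxima m w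

length-prependMaxima : ∀ m w → length (prependMaxima m w) ≡ m + length w
length-prependMaxima zero    w = refl
length-prependMaxima (suc m) w = cong suc (length-prependMaxima m w)

-- The decreasing permutation of length n + 1.
descending : ℕ → Word
descending n = prependMaxima (suc n) []

-- The permutation (n + 3) ... 4 3 1 2 of length n + 3.
ascentAtEnd : ℕ → Word
ascentAtEnd n = prependMaxima (suc n) (1 ∷ 2 ∷ [])

prependMaxima-perm : ∀ m {w} → IsPermutation w → IsPermutation (prependMaxima m w)
prependMaxima-perm zero    perm = perm
prependMaxima-perm (suc m) perm = prependMax-perm (prependMaxima-perm m perm)

perm-below : ∀ {w} → IsPermutation w → All (_< suc (length w)) w
perm-below perm = All.tabulate (λ y∈w → s≤s (perm-bounded perm y∈w))

prependMaxima-dominant : ∀ m {w} → IsPermutation w → Dominant w → Dominant (prependMaxima m w)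
prependMaxima-dominant zero    perm dom = dom
prependMaxima-dominant (suc m) {w} perm dom =
  dominant-∷ {suc (length (prependMaxima m w))} {prependMaxima m w}
    (perm-below (prependMaxima-perm m perm)) (prependMaxima-dominant m perm dom)

-- The n-th triangular number, the index at which row n of the Pascal triangle starts.
triangle : ℕ → ℕ
triangle zero    = 0
triangle (suc n) = suc (triangle n + n)

-- The index at which row n + 1 of the Pascal triangle ends. Row 0 is left out, because its only
-- entry already counts as the start of the row.
rowEnd : ℕ → ℕ
rowEnd n = triangle (suc n) + suc n

inversions-descending : ∀ n → inversions (descending n) ≡ triangle n
inversions-descending zero    = refl
inversions-descending (suc n) = begin
  inversions (descending (suc n))
    ≡⟨ inversions-∷ (perm-below (prependMaxima-perm (suc n) ↭-refl)) ⟩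
  length (descending n) + inversions (descending n)
    ≡⟨ cong₂ _+_ (trans (length-prependMaxima (suc n) []) (+-identityʳ _)) (inversions-descending n) ⟩
  suc (n + triangle n) ≡⟨ cong suc (+-comm n (triangle n)) ⟩
  triangle (suc n) ∎
  where open ≡-Reasoning

inversions-ascentAtEnd : ∀ n → inversions (ascentAtEnd n) ≡ rowEnd n
inversions-ascentAtEnd zero    = refl
inversions-ascentAtEnd (suc n) = begin
  inversions (ascentAtEnd (suc n))
    ≡⟨ inversions-∷ (perm-below (prependMaxima-perm (suc n) {1 ∷ 2 ∷ []} ↭-refl)) ⟩
  length (ascentAtEnd n) + inversions (ascentAtEnd n)
    ≡⟨ cong₂ _+_ (length-prependMaxima (suc n) _) (inversions-ascentAtEnd n) ⟩
  suc n + 2 + rowEnd n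
    ≡⟨ solve 2 (λ n t → con 1 :+ n :+ con 2 :+ (t :+ (con 1 :+ n)) :=
                        con 1 :+ (t :+ (con 1 :+ n)) :+ (con 2 :+ n)) refl n (triangle (suc n)) ⟩
  rowEnd (suc n) ∎
  where open ≡-Reasoning; open +-*-Solver

-- Member k π: π is one of the permutations in the classification, and k is its number of
-- inversions.
data Member : ℕ → Word → Set where
  isDescending  : ∀ n → Member (triangle n) (descending n)
  isAscentAtEnd : ∀ n → Member (rowEnd n) (ascentAtEnd n)

-- In the second case n = 0 gives 12 itself, which is decomposable.
shape : ∀ π → π ≢ [] → IsPermutation π → Dominant π →
  (∃[ n ] π ≡ descending n) ⊎ (∃[ n ] π ≡ prependMaxima n (1 ∷ 2 ∷ []))
shape []       π≢[] _ _ = contradiction refl π≢[]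
shape (_ ∷ []) _ perm _ = inj₁ (0 , ↭-singleton-inv perm)
shape (x ∷ y ∷ []) _ perm _ with <-cmp x y
... | tri≈ _ x≡y _ = contradiction x≡y (unique-lookup (perm-unique perm) {0F} {1F} z<s)
... | tri> _ _ y<x with peelMax perm (y<x ∷ [])
...   | refl , perm′ with ↭-singleton-inv perm′
...     | refl = inj₁ (1 , refl)
-- Exchanging the two entries gives a permutation that begins with its maximum.
shape (x ∷ y ∷ []) _ perm _ | tri< x<y _ _
  with peelMax (↭-trans (↭-swap y x ↭-refl) perm) (x<y ∷ [])
...   | refl , perm′ with ↭-singleton-inv perm′
...     | refl = inj₂ (0 , refl)
shape (x ∷ w@(_ ∷ _ ∷ _)) _ perm dom =
  extend (shape w (λ ()) (proj₂ peeled) (dominant-tail {x} {w} dom))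
  where
  peeled : x ≡ suc (length w) × IsPermutation w
  peeled = peelMax perm (dominant-head dom)

  consMax : ∀ {v} → w ≡ v → x ∷ w ≡ suc (length v) ∷ v
  consMax refl = cong (_∷ w) (proj₁ peeled)

  extend : (∃[ n ] w ≡ descending n) ⊎ (∃[ n ] w ≡ prependMaxima n (1 ∷ 2 ∷ [])) →
           (∃[ n ] x ∷ w ≡ descending n) ⊎ (∃[ n ] x ∷ w ≡ prependMaxima n (1 ∷ 2 ∷ []))
  extend (inj₁ (n , w≡)) = inj₁ (suc n , consMax w≡)
  extend (inj₂ (n , w≡)) = inj₂ (suc n , consMax w≡)

member-I : ∀ {k π} → Member k π → I k patterns₄ π
member-I (isDescending n) =
  prependMaxima-perm (suc n) ↭-refl ,
  startsWithMax⇒indecomposable (prependMaxima n []) ,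
  inversions-descending n ,
  dominant⇒avoids {descending n} (prependMaxima-dominant (suc n) {[]} ↭-refl λ { {()} })
member-I (isAscentAtEnd n) =
  prependMaxima-perm (suc n) ↭-refl ,
  startsWithMax⇒indecomposable (prependMaxima n _) ,
  inversions-ascentAtEnd n ,
  dominant⇒avoids {ascentAtEnd n}
    (prependMaxima-dominant (suc n) {1 ∷ 2 ∷ []} ↭-refl dominant-short)

I-member : ∀ {k π} → I k patterns₄ π → Member k π
I-member {k} {π} (perm , (π≢[] , indec) , inv≡k , avoids)
  with shape π π≢[] perm (avoids⇒dominant (perm-unique perm) avoids)
... | inj₁ (n , refl) =
  subst (λ k → Member k _) (trans (sym (inversions-descending n)) inv≡k) (isDescending n)
... | inj₂ (zero , refl) =
  -- The word 12 is the sum of two permutations of length one.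
  contradiction ([ 1 ] , [ 1 ] , (↭-refl , λ ()) , (↭-refl , λ ()) , refl) indec
... | inj₂ (suc n , refl) =
  subst (λ k → Member k _) (trans (sym (inversions-ascentAtEnd n)) inv≡k) (isAscentAtEnd n)

-- Positions in the Pascal triangle

-- The row and the place in that row of the k-th entry, all counted from 0.
coordinates : ℕ → ℕ × ℕ
coordinates = fold (0 , 0) nextEntry

coordinates-triangle : ∀ n m → m ≤ n → coordinates (triangle n + m) ≡ (n , m)
coordinates-triangle zero    zero    _   = refl
coordinates-triangle (suc n) zero    _   = begin
  coordinates (triangle (suc n) + 0)       ≡⟨ cong coordinates (+-identityʳ (triangle (suc n))) ⟩
  nextEntry (coordinates (triangle n + n)) ≡⟨ cong nextEntry (coordinates-triangle n n ≤-refl) ⟩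
  nextEntry (n , n)
    ≡⟨ cong (if_then (n , suc n) else (suc n , 0)) (dec-false (n <? n) (<-irrefl refl)) ⟩
  (suc n , 0) ∎
  where open ≡-Reasoning
coordinates-triangle n (suc m) m<n = begin
  coordinates (triangle n + suc m)         ≡⟨ cong coordinates (+-suc (triangle n) m) ⟩
  nextEntry (coordinates (triangle n + m)) ≡⟨ cong nextEntry (coordinates-triangle n m (<⇒≤ m<n)) ⟩
  nextEntry (n , m)
    ≡⟨ cong (if_then (n , suc m) else (suc n , 0)) (dec-true (m <? n) m<n) ⟩
  (n , suc m) ∎
  where open ≡-Reasoning

coordinates-unique : ∀ {n m n′ m′} → m ≤ n → m′ ≤ n′ →
  triangle n + m ≡ triangle n′ + m′ → n ≡ n′ × m ≡ m′
coordinates-unique {n} {m} {n′} {m′} m≤n m′≤n′ eq = ,-injective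
  (trans (sym (coordinates-triangle n m m≤n))
    (trans (cong coordinates eq) (coordinates-triangle n′ m′ m′≤n′)))

coordinates-exist : ∀ k → ∃[ n ] ∃[ m ] m ≤ n × triangle n + m ≡ k
coordinates-exist zero = 0 , 0 , z≤n , refl
coordinates-exist (suc k) with coordinates-exist k
... | n , m , m≤n , refl with m≤n⇒m<n∨m≡n m≤n
...   | inj₁ m<n  = n , suc m , m<n , +-suc (triangle n) m
...   | inj₂ refl = suc n , 0 , z≤n , +-identityʳ _

-- The indices split into the row starts, the row ends after row 0, and the indices strictly
-- inside a row.
data Entry : ℕ → Set where
  first    : ∀ n → Entry (triangle n)
  last     : ∀ n → Entry (rowEnd n)
  interior : ∀ {n m} → m < n → Entry (triangle (suc n) + suc m)

entry : ∀ k → Entry k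
entry k with coordinates-exist k
... | n , zero , _ , refl = subst Entry (sym (+-identityʳ (triangle n))) (first n)
... | suc n , suc m , m≤n , refl with m≤n⇒m<n∨m≡n m≤n
...   | inj₁ m<n  = interior (s<s⁻¹ m<n)
...   | inj₂ refl = last n

triangle-injective : ∀ {i j} → triangle i ≡ triangle j → i ≡ j
triangle-injective eq = proj₁ (coordinates-unique z≤n z≤n (cong (_+ 0) eq))

rowEnd-injective : ∀ {i j} → rowEnd i ≡ rowEnd j → i ≡ j
rowEnd-injective eq = suc-injective (proj₁ (coordinates-unique ≤-refl ≤-refl eq))

first≢positive : ∀ {i n m} → suc m ≤ n → triangle i ≢ triangle n + suc m
first≢positive {i} m<n eq =
  0≢1+n (proj₂ (coordinates-unique {i} z≤n m<n (trans (+-identityʳ (triangle i)) eq)))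

interior≢last : ∀ {n m i} → m < n → triangle (suc n) + suc m ≢ rowEnd i
interior≢last {n} {m} {i} m<n eq
  with coordinates-unique {suc n} {suc m} {suc i} {suc i} (s≤s (<⇒≤ m<n)) ≤-refl eq
... | refl , refl = <-irrefl refl m<n

-- The Pascal triangle with its values above 1 replaced by 0

0<nCm : ∀ {n m} → m ≤ n → 0 < n C m
0<nCm {n}     {zero}  _   = s≤s z≤n
0<nCm {suc n} {suc m} m≤n = subst (0 <_) (nCk+nC[k+1]≡[n+1]C[k+1] n m)
  (≤-trans (0<nCm (s≤s⁻¹ m≤n)) (m≤m+n _ _))

1<nCm : ∀ {n m} → m < n → 1 < suc n C suc m
1<nCm {n} {m} m<n = subst (1 <_) (nCk+nC[k+1]≡[n+1]C[k+1] n m)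
  (+-mono-≤ (0<nCm (<⇒≤ m<n)) (0<nCm m<n))

-- The k-th entry of the Pascal triangle, or 0 if that entry exceeds 1.
count : ℕ → ℕ
count k = zeroAboveOne (pascal k)

count-coordinates : ∀ n m → m ≤ n → count (triangle n + m) ≡ zeroAboveOne (n C m)
count-coordinates n m m≤n = cong (λ (n , m) → zeroAboveOne (n C m)) (coordinates-triangle n m m≤n)

count-first : ∀ n → count (triangle n) ≡ 1
count-first n = trans (cong count (sym (+-identityʳ (triangle n)))) (count-coordinates n 0 z≤n)

count-last : ∀ n → count (rowEnd n) ≡ 1
count-last n = trans (count-coordinates (suc n) (suc n) ≤-refl) (cong zeroAboveOne (nCn≡1 (suc n)))

count-interior : ∀ {n m} → m < n → count (triangle (suc n) + suc m) ≡ 0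
count-interior {n} {m} m<n = trans (count-coordinates (suc n) (suc m) (s≤s (<⇒≤ m<n)))
  (cong (if_then 0 else (suc n C suc m)) (dec-true (suc n C suc m >? 1) (1<nCm m<n)))

-- Cardinalities

cardinality-singleton : ∀ {P : Word → Set} {w} → P w → (∀ {x} → P x → x ≡ w) → HasCardinality P 1
cardinality-singleton {w = w} pw unique =
  [ w ] , [] ∷ [] , (λ _ → mk⇔ (λ { (here refl) → pw }) (here ∘ unique)) , refl

member-cardinality : ∀ k → HasCardinality (I k patterns₄) (count k)
member-cardinality k with entry k
... | first n = subst (HasCardinality _) (sym (count-first n))
  (cardinality-singleton (member-I (isDescending n)) (λ p → unique refl (I-member p)))
  where
  unique : ∀ {k x} → k ≡ triangle n → Member k x → x ≡ descending n
  unique eq (isDescending _)  = cong descending (triangle-injective eq)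
  unique eq (isAscentAtEnd _) = contradiction (sym eq) (first≢positive ≤-refl)
... | last n = subst (HasCardinality _) (sym (count-last n))
  (cardinality-singleton (member-I (isAscentAtEnd n)) (λ p → unique refl (I-member p)))
  where
  unique : ∀ {k x} → k ≡ rowEnd n → Member k x → x ≡ ascentAtEnd n
  unique eq (isDescending _)  = contradiction eq (first≢positive ≤-refl)
  unique eq (isAscentAtEnd _) = cong ascentAtEnd (rowEnd-injective eq)
... | interior {n} {m} m<n = subst (HasCardinality _) (sym (count-interior m<n))
  ([] , [] , (λ _ → mk⇔ (λ ()) (λ p → contradiction refl (none (I-member p)))) , refl)
  where
  none : ∀ {k x} → Member k x → k ≢ triangle (suc n) + suc m
  none (isDescending _)  = first≢positive (s≤s (<⇒≤ m<n))
  none (isAscentAtEnd _) = interior≢last m<n ∘ sym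

-- The generating function

x^-same : ∀ k → (x^ k) k ≡ 1
x^-same k = cong (if_then 1 else 0) (dec-true (k ≟ k) refl)

x^-different : ∀ {k e} → k ≢ e → (x^ e) k ≡ 0
x^-different {k} {e} k≢e = cong (if_then 1 else 0) (dec-false (k ≟ e) k≢e)

partialSum-cong : ∀ {f g : ℕ → Series} {k} → (∀ i → f i k ≡ g i k) →
  ∀ N → partialSum f N k ≡ partialSum g N k
partialSum-cong f≗g zero    = refl
partialSum-cong f≗g (suc N) = cong₂ _+_ (partialSum-cong f≗g N) (f≗g N)

partialSum-⊞ : ∀ (f g : ℕ → Series) N k →
  partialSum (λ i → f i ⊞ g i) N k ≡ partialSum f N k + partialSum g N k
partialSum-⊞ f g zero    k = refl
partialSum-⊞ f g (suc N) k = trans (cong (_+ (f N k + g N k)) (partialSum-⊞ f g N k))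
  (solve 4 (λ p q x y → p :+ q :+ (x :+ y) := p :+ x :+ (q :+ y)) refl
    (partialSum f N k) (partialSum g N k) (f N k) (g N k))
  where open +-*-Solver

-- The coefficient of x^k in a sum of monomials none of which is x^k.
partialSum-absent : ∀ (e : ℕ → ℕ) {k} N → (∀ i → i < N → k ≢ e i) →
  partialSum (λ i → x^ (e i)) N k ≡ 0
partialSum-absent e zero    k≢e = refl
partialSum-absent e (suc N) k≢e =
  cong₂ _+_ (partialSum-absent e N (λ i i<N → k≢e i (m<n⇒m<1+n i<N))) (x^-different (k≢e N ≤-refl))

-- The coefficient of x^(e j) in a sum of distinct monomials one of which is x^(e j).
partialSum-present : ∀ (e : ℕ → ℕ) → (∀ {i j} → e i ≡ e j → i ≡ j) →
  ∀ {j} N → j < N → partialSum (λ i → x^ (e i)) N (e j) ≡ 1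
partialSum-present e inj {j} (suc N) j<1+N with m≤n⇒m<n∨m≡n (s≤s⁻¹ j<1+N)
... | inj₁ j<N  = cong₂ _+_ (partialSum-present e inj N j<N) (x^-different (<⇒≢ j<N ∘ inj))
... | inj₂ refl =
  cong₂ _+_ (partialSum-absent e N (λ i i<N eq → <⇒≢ i<N (sym (inj eq)))) (x^-same (e N))

-- A monomial that contributes to the coefficient of x^k therefore has an index i ≤ k, which
-- bounds the number of terms needed.
n≤triangle : ∀ n → n ≤ triangle n
n≤triangle zero    = z≤n
n≤triangle (suc n) = s≤s (m≤n+m n (triangle n))

triangle-double : ∀ n → n * (n + 1) ≡ triangle n * 2
triangle-double zero    = refl
triangle-double (suc n) = begin
  suc n * (suc n + 1)
    ≡⟨ solve 1 (λ n → (con 1 :+ n) :* (con 1 :+ n :+ con 1) :=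
                      n :* (n :+ con 1) :+ (con 1 :+ n) :* con 2) refl n ⟩
  n * (n + 1) + suc n * 2 ≡⟨ cong (_+ suc n * 2) (triangle-double n) ⟩
  triangle n * 2 + suc n * 2
    ≡⟨ solve 2 (λ t n → t :* con 2 :+ (con 1 :+ n) :* con 2 :=
                        (con 1 :+ (t :+ n)) :* con 2) refl (triangle n) n ⟩
  triangle (suc n) * 2 ∎
  where open ≡-Reasoning; open +-*-Solver

first-exponent : ∀ i → i * (i + 1) / 2 ≡ triangle i
first-exponent i = trans (cong (_/ 2) (triangle-double i)) (m*n/n≡m (triangle i) 2)

last-exponent : ∀ i → (i + 1) * (i + 4) / 2 ≡ rowEnd i
last-exponent i = trans (cong (_/ 2) double) (m*n/n≡m (rowEnd i) 2)
  where
  open ≡-Reasoning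
  open +-*-Solver
  double : (i + 1) * (i + 4) ≡ rowEnd i * 2
  double = begin
    (i + 1) * (i + 4)
      ≡⟨ solve 1 (λ i → (i :+ con 1) :* (i :+ con 4) :=
                        (con 1 :+ i) :* (con 1 :+ i :+ con 1) :+ (con 1 :+ i) :* con 2) refl i ⟩
    suc i * (suc i + 1) + suc i * 2  ≡⟨ cong (_+ suc i * 2) (triangle-double (suc i)) ⟩
    triangle (suc i) * 2 + suc i * 2 ≡⟨ *-distribʳ-+ 2 (triangle (suc i)) (suc i) ⟨
    rowEnd i * 2                     ∎

partialSum-count : ∀ k N → suc k ≤ N →
  partialSum (λ i → x^ (triangle i)) N k + partialSum (λ i → x^ (rowEnd i)) N k ≡ count k
partialSum-count k N k<N with entry k
... | first n = trans
  (cong₂ _+_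
    (partialSum-present triangle triangle-injective N (≤-<-trans (n≤triangle n) k<N))
    (partialSum-absent rowEnd N (λ _ _ → first≢positive ≤-refl)))
  (sym (count-first n))
... | last n = trans
  (cong₂ _+_
    (partialSum-absent triangle N (λ _ _ → first≢positive ≤-refl ∘ sym))
    (partialSum-present rowEnd rowEnd-injective N
      (≤-<-trans (≤-trans (n≤1+n n) (m≤n+m (suc n) (triangle (suc n)))) k<N)))
  (sym (count-last n))
... | interior m<n = trans
  (cong₂ _+_
    (partialSum-absent triangle N (λ _ _ → first≢positive (s≤s (<⇒≤ m<n)) ∘ sym))
    (partialSum-absent rowEnd N (λ _ _ → interior≢last m<n)))
  (sym (count-interior m<n))

theorem24 :
    let patterns : List Word
        patterns = (1 ∷ 2 ∷ 3 ∷ []) ∷ (1 ∷ 3 ∷ 2 ∷ []) ∷ (2 ∷ 1 ∷ 3 ∷ []) ∷ (2 ∷ 3 ∷ 1 ∷ []) ∷ []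
    in Σ[ c ∈ (ℕ → ℕ) ] (∀ (k : ℕ) → HasCardinality (I k patterns) (c k))
       × (∀ (k : ℕ) → c k ≡ zeroAboveOne (pascal k))
       × c IsSumOf (λ i → x^ (i * (i + 1) / 2) ⊞ x^ ((i + 1) * (i + 4) / 2))
theorem24 = count , member-cardinality , (λ _ → refl) , λ k → suc k , λ N k<N → begin
  partialSum (λ i → x^ (i * (i + 1) / 2) ⊞ x^ ((i + 1) * (i + 4) / 2)) N k
    ≡⟨ partialSum-cong (λ i → cong₂ (λ e e′ → (x^ e) k + (x^ e′) k)
                                     (first-exponent i) (last-exponent i)) N ⟩
  partialSum (λ i → x^ (triangle i) ⊞ x^ (rowEnd i)) N k
    ≡⟨ partialSum-⊞ (λ i → x^ (triangle i)) (λ i → x^ (rowEnd i)) N k ⟩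
  partialSum (λ i → x^ (triangle i)) N k + partialSum (λ i → x^ (rowEnd i)) N k
    ≡⟨ partialSum-count k N k<N ⟩
  count k ∎
  where open ≡-Reasoning
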